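{- Let $D=(V,A)$ be a finite connected directed acyclic graph with $V=\{1,\ldots,n\}$, whose vertices are ordered so that $u<v$ whenever $(u,v)\in A$, and suppose that $D$ has at least one topological additive numbering. Let $Q\subseteq V$ be a (nonempty) clique of $D$, and let $q_F$ and $q_L$ be the smallest and largest vertices of $Q$, respectively. Then $$\eta_t(D)\ \geq\ \left\lceil \frac{d(q_F)+1}{d(q_L)-|Q|+2}\right\rceil .$$
   Context: For a directed acyclic graph $D=(V,A)$, $G(D)$ denotes its undirected underlying graph, $N(v)$ denotes the set of neighbors of $v$ in $G(D)$ (both in- and out-neighbors), and $d(v)=|N(v)|$. A clique of $D$ is a set of vertices that are pairwise adjacent in $G(D)$. $\mathbb{N}$ denotes the positive integers. For a labeling $f:V\to\mathbb{N}$, put $S(v)=\sum_{w\in N(v)}f(w)$. The labeling $f$ is a topological additive numbering of $D$ if $S(u)<S(v)$ for every $(u,v)\in A$; it is a topological additive $k$-numbering if moreover $k$ is the largest label used in $f$. If $D$ has at least one topological additive numbering, $\eta_t(D)$ is the least $k$ for which $D$ has a topological additive $k$-numbering. -}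

module Defs where

open import Data.Fin.Base as Fin using (Fin; zero; suc; toℕ; fromℕ<; finToFun; funToFin)
open import Data.Fin.Properties using (all?; any?; toℕ-fromℕ<; finToFun-funToFin)
  renaming (_≟_ to _≟ᶠ_)
open import Data.Fin.Subset using (Subset; inside; outside; _∈_; ∣_∣)
open import Data.Fin.Subset.Properties using (p⊆q⇒∣p∣≤∣q∣)
open import Data.List.Base using (allFin)
open import Data.List.Extrema.Nat using (argmax; f[xs]≤f[argmax])
open import Data.List.Membership.Propositional.Properties using (∈-allFin)
import Data.List.Relation.Unary.All as All
open import Data.Nat.Base using (ℕ; zero; suc; _+_; _∸_; _≤_; _<_; z≤n; s≤s; NonZero; >-nonZero; >-nonZero⁻¹)
open import Data.Nat.Properties using (_≟_; _≤?_; _<?_; ≤-trans; m<n⇒0<n∸m; n≤1+n; ≤-refl; +-comm; ≤-reflexive)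
open import Data.Product.Base using (∃; _×_; _,_; proj₁; proj₂)
open import Data.Sum.Base using (_⊎_)
open import Data.Vec.Base using ([]; _∷_; tabulate; _[_]≔_)
open import Data.Vec.Properties using (lookup⇒[]=; lookup∘tabulate; lookup∘updateAt; lookup∘updateAt′)
open import Function.Base using (_∘_)
open import Level using (0ℓ)
open import Relation.Binary.Core using (Rel)
open import Relation.Binary.Construct.Closure.ReflexiveTransitive using (Star)
open import Relation.Binary.Construct.Closure.Transitive using (TransClosure)
open import Relation.Binary.Definitions using (Decidable)
open import Relation.Binary.PropositionalEquality
  using (_≡_; _≢_; _≗_; refl; sym; trans; cong; cong₂; subst; subst₂)
open import Relation.Nullary using (¬_; yes; no; does; contradiction)
open import Relation.Nullary.Decidable using (map′; _×-dec_; _⊎-dec_; _→-dec_; dec-true)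
import Relation.Unary as U

private variable
  n k : ℕ

-- The vertex set {1, …, n} is represented by Fin n with its usual order.
record DAG (n : ℕ) : Set₁ where
  field
    Arc     : Rel (Fin n) 0ℓ
    arc?    : Decidable Arc
    acyclic : ∀ {v} → ¬ TransClosure Arc v v

  Adjacent : Rel (Fin n) 0ℓ
  Adjacent u v = Arc u v ⊎ Arc v u

  adjacent? : Decidable Adjacent
  adjacent? u v = arc? u v ⊎-dec arc? v u

  N : Fin n → Subset n
  N v = tabulate (λ w → does (adjacent? v w))

  d : Fin n → ℕ
  d v = ∣ N v ∣

  Connected : Set
  Connected = ∀ u v → Star Adjacent u v

  TopologicallyOrdered : Set
  TopologicallyOrdered = ∀ {u v} → Arc u v → u Fin.< v

  IsClique : Subset n → Set
  IsClique Q = ∀ {u v} → u ∈ Q → v ∈ Q → u ≢ v → Adjacent u v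

open DAG

IsSmallest IsLargest : Subset n → Fin n → Set
IsSmallest Q q = q ∈ Q × (∀ {v} → v ∈ Q → q Fin.≤ v)
IsLargest  Q q = q ∈ Q × (∀ {v} → v ∈ Q → v Fin.≤ q)

sumOver : Subset n → (Fin n → ℕ) → ℕ
sumOver []            f = 0
sumOver (inside  ∷ p) f = f zero + sumOver p (f ∘ suc)
sumOver (outside ∷ p) f = sumOver p (f ∘ suc)

S : DAG n → (Fin n → ℕ) → Fin n → ℕ
S D f v = sumOver (N D v) f

IsTopAddNumbering : DAG n → (Fin n → ℕ) → Set
IsTopAddNumbering D f = (∀ v → 0 < f v) × (∀ u v → Arc D u v → S D f u < S D f v)

IsMaxLabel : (Fin n → ℕ) → ℕ → Set
IsMaxLabel f k = (∀ v → f v ≤ k) × ∃ λ v → f v ≡ k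

IsTopAddKNumbering : DAG n → ℕ → (Fin n → ℕ) → Set
IsTopAddKNumbering D k f = IsTopAddNumbering D f × IsMaxLabel f k

HasTopAddNumbering : DAG n → Set
HasTopAddNumbering D = ∃ (IsTopAddNumbering D)

HasTopAddKNumbering : DAG n → ℕ → Set
HasTopAddKNumbering D k = ∃ (IsTopAddKNumbering D k)

IsLeast : (ℕ → Set) → ℕ → Set
IsLeast P k = P k × (∀ {j} → P j → k ≤ j)

-- Existence of k-numberings is decidable (there are finitely many candidate
-- labelings), so the least such k can be computed.

least : {P : ℕ → Set} → U.Decidable P → ∃ P → ∃ (IsLeast P)
least {P} P? (k , Pk) = search P P? k Pk
  where
  search : (P : ℕ → Set) → U.Decidable P → ∀ k → P k → ∃ (IsLeast P)
  search P P? zero    P0 = 0 , P0 , λ _ → z≤n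
  search P P? (suc k) Pk with P? 0
  ... | yes P0 = 0 , P0 , λ _ → z≤n
  ... | no ¬P0 with search (P ∘ suc) (P? ∘ suc) k Pk
  ...   | m , Pm , m≤ = suc m , Pm , bound
    where
    bound : ∀ {j} → P j → suc m ≤ j
    bound {zero}  P0 = contradiction P0 ¬P0
    bound {suc j} Pj = s≤s (m≤ Pj)

sumOver-cong : (p : Subset n) {f g : Fin n → ℕ} → f ≗ g → sumOver p f ≡ sumOver p g
sumOver-cong []            f≗g = refl
sumOver-cong (inside  ∷ p) f≗g = cong₂ _+_ (f≗g zero) (sumOver-cong p (f≗g ∘ suc))
sumOver-cong (outside ∷ p) f≗g = sumOver-cong p (f≗g ∘ suc)

isTopAddKNumbering-resp : (D : DAG n) {f g : Fin n → ℕ} → f ≗ g →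
                          IsTopAddKNumbering D k f → IsTopAddKNumbering D k g
isTopAddKNumbering-resp D f≗g ((pos , inc) , f≤k , v , fv≡k) =
  ( (λ u → subst (0 <_) (f≗g u) (pos u))
  , (λ u w a → subst₂ _<_ (sumOver-cong (N D u) f≗g) (sumOver-cong (N D w) f≗g) (inc u w a))
  ) , (λ u → subst (_≤ _) (f≗g u) (f≤k u)) , v , trans (sym (f≗g v)) fv≡k

isTopAddKNumbering? : (D : DAG n) (k : ℕ) → U.Decidable (IsTopAddKNumbering D k)
isTopAddKNumbering? D k f =
  (all? (λ v → 0 <? f v) ×-dec
   all? (λ u → all? λ v → arc? D u v →-dec (S D f u <? S D f v)))
  ×-dec (all? (λ v → f v ≤? k) ×-dec any? (λ v → f v ≟ k))

hasTopAddKNumbering? : (D : DAG n) → U.Decidable (HasTopAddKNumbering D)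
hasTopAddKNumbering? {n} D k =
  map′ (λ (i , h) → label i , h) encode (any? (isTopAddKNumbering? D k ∘ label))
  where
  label : Fin _ → Fin n → ℕ
  label i = toℕ ∘ finToFun {suc k} {n} i

  encode : HasTopAddKNumbering D k → ∃ (IsTopAddKNumbering D k ∘ label)
  encode (f , h@(_ , f≤k , _)) = funToFin g , isTopAddKNumbering-resp D f≗label h
    where
    g : Fin n → Fin (suc k)
    g v = fromℕ< (s≤s (f≤k v))

    f≗label : f ≗ label (funToFin g)
    f≗label v = trans (sym (toℕ-fromℕ< (s≤s (f≤k v)))) (cong toℕ (sym (finToFun-funToFin g v)))

∃maxLabel : .{{NonZero n}} → (f : Fin n → ℕ) → ∃ (IsMaxLabel f)
∃maxLabel {n} f = f v̂ , (λ v → All.lookup (f[xs]≤f[argmax] v₀ (allFin n)) (∈-allFin v)) , v̂ , refl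
  where
  v₀ v̂ : Fin n
  v₀ = fromℕ< (>-nonZero⁻¹ n)
  v̂  = argmax f v₀ (allFin n)

∃ηₜ : .{{NonZero n}} → (D : DAG n) → HasTopAddNumbering D → ∃ (IsLeast (HasTopAddKNumbering D))
∃ηₜ D (f , h) with k , max ← ∃maxLabel f = least (hasTopAddKNumbering? D) (k , f , h , max)

-- A DAG without vertices has no largest label, hence the NonZero argument.
ηₜ : .{{NonZero n}} → (D : DAG n) → HasTopAddNumbering D → ℕ
ηₜ D num = proj₁ (∃ηₜ D num)

ηₜ-isLeast : .{{_ : NonZero n}} (D : DAG n) (num : HasTopAddNumbering D) →
             IsLeast (HasTopAddKNumbering D) (ηₜ D num)
ηₜ-isLeast D num = proj₂ (∃ηₜ D num)

∣p[x]≔inside∣≤1+∣p∣ : (p : Subset n) (x : Fin n) → ∣ p [ x ]≔ inside ∣ ≤ suc ∣ p ∣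
∣p[x]≔inside∣≤1+∣p∣ (inside  ∷ p) zero    = n≤1+n _
∣p[x]≔inside∣≤1+∣p∣ (outside ∷ p) zero    = ≤-refl
∣p[x]≔inside∣≤1+∣p∣ (inside  ∷ p) (suc x) = s≤s (∣p[x]≔inside∣≤1+∣p∣ p x)
∣p[x]≔inside∣≤1+∣p∣ (outside ∷ p) (suc x) = ∣p[x]≔inside∣≤1+∣p∣ p x

module _ (D : DAG n) {Q : Subset n} (clique : IsClique D Q) {v : Fin n} (v∈Q : v ∈ Q) where

  ∣Q∣≤1+d : ∣ Q ∣ ≤ suc (d D v)
  ∣Q∣≤1+d = ≤-trans (p⊆q⇒∣p∣≤∣q∣ Q⊆) (∣p[x]≔inside∣≤1+∣p∣ (N D v) v)
    where
    Q⊆ : ∀ {u} → u ∈ Q → u ∈ N D v [ v ]≔ inside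
    Q⊆ {u} u∈Q with u ≟ᶠ v
    ... | yes refl = lookup⇒[]= v _ (lookup∘updateAt v (N D v))
    ... | no  u≢v  = lookup⇒[]= u _ (trans (lookup∘updateAt′ u v u≢v (N D v))
      (trans (lookup∘tabulate (λ w → does (adjacent? D v w)) u)
             (dec-true (adjacent? D v u) (clique v∈Q u∈Q (u≢v ∘ sym)))))

  -- Adding 2 before subtracting means that truncated subtraction never truncates.
  d+2∸∣Q∣-nonZero : NonZero (d D v + 2 ∸ ∣ Q ∣)
  d+2∸∣Q∣-nonZero = >-nonZero (m<n⇒0<n∸m (≤-trans (s≤s ∣Q∣≤1+d) (≤-reflexive (+-comm 2 (d D v)))))

{-# OPTIONS --safe #-}

-- The integer-valued S increases strictly along the clique, whose vertices are pairwise joined by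
-- arcs, so S(q_F) + |Q| − 1 ≤ S(q_L).  For v ∈ Q put R(v) = N(v) ∖ Q.  Then S(v) + f(v) = f(Q) + f(R(v)),
-- and cancelling f(Q) gives |Q| − 1 + f(R(q_F)) + f(q_L) ≤ f(q_F) + f(R(q_L)).  Labels lie between
-- 1 and k, so the left side is at least d(q_F) + 1 and the right side at most k (d(q_L) − |Q| + 2).
module Submission where

open import Defs
open import Data.Fin.Base as Fin using (Fin; zero; suc)
import Data.Fin.Properties as Fin
open import Data.Fin.Subset using (Subset; inside; outside; Nonempty; ∣_∣; _∈_; _⊆_; _─_; _-_; ⁅_⁆; ⊥)
open import Data.Fin.Subset.Properties using (x∈⁅y⁆⇒x≡y; p─q⊆p; drop-∷-⊆)
open import Data.Integer.Base as ℤ using (ℤ)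
open import Data.Integer.DivMod using (n<s[n/ℕd]*d; div-pos-is-/ℕ)
import Data.Integer.Properties as ℤ
open import Data.Nat.Base using (ℕ; zero; suc; NonZero; _+_; _*_; _∸_; _≤_; _<_; z≤n; s≤s)
open import Data.Nat.Properties
open import Data.Nat.Tactic.RingSolver using (solve-∀)
open import Data.Product.Base using (_×_; _,_; proj₁; proj₂)
open import Data.Rational.Unnormalised.Base using (_/_; ceiling)
open import Data.Sum.Base using (inj₁; inj₂)
open import Data.Vec.Base using ([]; _∷_; here; there)
open import Data.Vec.Properties using (lookup⇒[]=; lookup∘tabulate)
open import Function.Base using (_∘_)
open import Relation.Binary.PropositionalEquality
open import Relation.Nullary using (yes; no; contradiction)
open import Relation.Nullary.Decidable using (dec-true)

private variable
  n k : ℕ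

-- The ceiling unfolds to the negated floor of `- i / d`, so it suffices that `- j` is at most this
-- floor `q`. That follows from `- j * d ≤ - i < (1 + q) * d` by cancelling `d` in the strict
-- inequality between the ends.
⌈i/d⌉≤j : ∀ {i j : ℤ} (d : ℕ) .{{_ : NonZero d}} → i ℤ.≤ j ℤ.* ℤ.+ d → ⌈ i / d ⌉ ℤ.≤ j
⌈i/d⌉≤j {i} {j} d@(suc _) i≤jd = begin
  ⌈ i / d ⌉       ≡⟨ cong ℤ.-_ (div-pos-is-/ℕ (ℤ.- i) d) ⟩
  ℤ.- q           ≤⟨ ℤ.neg-mono-≤ -j≤q ⟩
  ℤ.- (ℤ.- j)     ≡⟨ ℤ.neg-involutive j ⟩
  j               ∎
  where
  open ℤ.≤-Reasoning
  q = (ℤ.- i) ℤ./ℕ d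

  -j*d<[1+q]*d : ℤ.- j ℤ.* ℤ.+ d ℤ.< ℤ.suc q ℤ.* ℤ.+ d
  -j*d<[1+q]*d = begin-strict
    ℤ.- j ℤ.* ℤ.+ d      ≡⟨ ℤ.neg-distribˡ-* j (ℤ.+ d) ⟨
    ℤ.- (j ℤ.* ℤ.+ d)    ≤⟨ ℤ.neg-mono-≤ i≤jd ⟩
    ℤ.- i                <⟨ n<s[n/ℕd]*d (ℤ.- i) d ⟩
    ℤ.suc q ℤ.* ℤ.+ d    ∎

  -j≤q : ℤ.- j ℤ.≤ q
  -j≤q = subst (ℤ.- j ℤ.≤_) (ℤ.pred-suc q)
    (ℤ.i<j⇒i≤pred[j] (ℤ.*-cancelʳ-<-nonNeg {j = ℤ.suc q} (ℤ.+ d) -j*d<[1+q]*d))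

sumOver-const : (p : Subset n) (c : ℕ) → sumOver p (λ _ → c) ≡ ∣ p ∣ * c
sumOver-const []            c = refl
sumOver-const (inside  ∷ p) c = cong (_+_ c) (sumOver-const p c)
sumOver-const (outside ∷ p) c = sumOver-const p c

sumOver-mono : (p : Subset n) {f g : Fin n → ℕ} → (∀ v → f v ≤ g v) → sumOver p f ≤ sumOver p g
sumOver-mono []            f≤g = z≤n
sumOver-mono (inside  ∷ p) f≤g = +-mono-≤ (f≤g zero) (sumOver-mono p (f≤g ∘ suc))
sumOver-mono (outside ∷ p) f≤g = sumOver-mono p (f≤g ∘ suc)

∣p∣≤sumOver : (p : Subset n) {f : Fin n → ℕ} → (∀ v → 0 < f v) → ∣ p ∣ ≤ sumOver p f
∣p∣≤sumOver p pos = ≤-trans (≤-reflexive (trans (sym (*-identityʳ _)) (sym (sumOver-const p 1))))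
                            (sumOver-mono p pos)

sumOver≤∣p∣*k : (p : Subset n) {f : Fin n → ℕ} → (∀ v → f v ≤ k) → sumOver p f ≤ ∣ p ∣ * k
sumOver≤∣p∣*k {k = k} p f≤k = ≤-trans (sumOver-mono p f≤k) (≤-reflexive (sumOver-const p k))

sumOver-─ : {p q : Subset n} → p ⊆ q → (f : Fin n → ℕ) →
            sumOver q f ≡ sumOver p f + sumOver (q ─ p) f
sumOver-─ {p = []}          {[]}          p⊆q f = refl
sumOver-─ {p = inside  ∷ p} {inside  ∷ q} p⊆q f =
  trans (cong (_+_ (f zero)) (sumOver-─ (drop-∷-⊆ p⊆q) (f ∘ suc))) (sym (+-assoc (f zero) _ _))
sumOver-─ {p = inside  ∷ p} {outside ∷ q} p⊆q f with () ← p⊆q here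
sumOver-─ {p = outside ∷ p} {inside  ∷ q} p⊆q f =
  trans (cong (_+_ (f zero)) (sumOver-─ (drop-∷-⊆ p⊆q) (f ∘ suc)))
        (x+[y+z]≡y+[x+z] (f zero) (sumOver p (f ∘ suc)) _)
  where
  x+[y+z]≡y+[x+z] : ∀ x y z → x + (y + z) ≡ y + (x + z)
  x+[y+z]≡y+[x+z] = solve-∀
sumOver-─ {p = outside ∷ p} {outside ∷ q} p⊆q f = sumOver-─ (drop-∷-⊆ p⊆q) (f ∘ suc)

sumOver-⊥ : (f : Fin n → ℕ) → sumOver ⊥ f ≡ 0
sumOver-⊥ {zero}  f = refl
sumOver-⊥ {suc n} f = sumOver-⊥ (f ∘ suc)

sumOver-⁅⁆ : (x : Fin n) (f : Fin n → ℕ) → sumOver ⁅ x ⁆ f ≡ f x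
sumOver-⁅⁆ zero    f = trans (cong (_+_ (f zero)) (sumOver-⊥ (f ∘ suc))) (+-identityʳ _)
sumOver-⁅⁆ (suc x) f = sumOver-⁅⁆ x (f ∘ suc)

sumOver-remove : {p : Subset n} {x : Fin n} → x ∈ p → (f : Fin n → ℕ) →
                 sumOver p f ≡ f x + sumOver (p - x) f
sumOver-remove {p = p} {x} x∈p f =
  -- `p - x` unfolds to `p ─ ⁅ x ⁆`, so this is the splitting of `p` along a singleton.
  trans (sumOver-─ (λ y∈⁅x⁆ → subst (_∈ _) (sym (x∈⁅y⁆⇒x≡y x y∈⁅x⁆)) x∈p) f)
        (cong (_+ sumOver (p - x) f) (sumOver-⁅⁆ x f))

x∈p-y⇒x≢y : (p : Subset n) {x y : Fin n} → x ∈ p - y → x ≢ y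
x∈p-y⇒x≢y (_ ∷ p) {zero}  ()         refl
x∈p-y⇒x≢y (_ ∷ p) {suc x} (there x∈) refl = x∈p-y⇒x≢y p x∈ refl

StrictlyIncreasingOn : Subset n → (Fin n → ℕ) → Set
StrictlyIncreasingOn p g = ∀ {u v} → u ∈ p → v ∈ p → u Fin.< v → g u < g v

-- The values of `g` on `p` are `∣ p ∣` distinct numbers in the half-open interval from `a` to `b`.
-- The induction runs through `p` in increasing order and raises `a` past each value met; `a ≤ b`
-- settles the empty set.
∣p∣+a≤b : ∀ {a b} (p : Subset n) (g : Fin n → ℕ) → StrictlyIncreasingOn p g → a ≤ b →
          (∀ {v} → v ∈ p → a ≤ g v × g v < b) → ∣ p ∣ + a ≤ b
∣p∣+a≤b []            g inc a≤b bounds = a≤b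
∣p∣+a≤b (outside ∷ p) g inc a≤b bounds =
  ∣p∣+a≤b p (g ∘ suc) (λ u∈ v∈ u<v → inc (there u∈) (there v∈) (s≤s u<v)) a≤b (bounds ∘ there)
∣p∣+a≤b {a = a} {b} (inside ∷ p) g inc a≤b bounds with a≤g₀ , g₀<b ← bounds here = begin
  suc (∣ p ∣ + a)         ≡⟨ +-suc ∣ p ∣ a ⟨
  ∣ p ∣ + suc a           ≤⟨ +-monoʳ-≤ ∣ p ∣ (s≤s a≤g₀) ⟩
  -- The new lower end is `suc (g zero)`: by monotonicity all later values exceed `g zero`, and
  -- `g₀<b` is the new `a ≤ b`.
  ∣ p ∣ + suc (g zero)    ≤⟨ ∣p∣+a≤b p (g ∘ suc) (λ u∈ v∈ u<v → inc (there u∈) (there v∈) (s≤s u<v))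
                               g₀<b (λ v∈ → inc here (there v∈) (s≤s z≤n) , proj₂ (bounds (there v∈))) ⟩
  b                       ∎
  where open ≤-Reasoning

strictlyIncreasing⇒≤ : {p : Subset n} {g : Fin n → ℕ} → StrictlyIncreasingOn p g →
                       ∀ {u v} → u ∈ p → v ∈ p → u Fin.≤ v → g u ≤ g v
strictlyIncreasing⇒≤ {g = g} inc {u} {v} u∈ v∈ u≤v with u Fin.≟ v
... | yes refl = ≤-refl
... | no  u≢v  = <⇒≤ (inc u∈ v∈ (Fin.≤∧≢⇒< u≤v u≢v))

module _ (D : DAG n) {Q : Subset n} (clique : DAG.IsClique D Q) where
  open DAG D

  -- Since v ∉ N v, this is N v ─ Q; with Q - v in place of Q the fact v ∉ N v is never needed.
  N─Q : Fin n → Subset n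
  N─Q v = N v ─ (Q - v)

  Q-v⊆N : ∀ {v} → v ∈ Q → Q - v ⊆ N v
  Q-v⊆N {v} v∈Q {u} u∈ = lookup⇒[]= u (N v) (trans (lookup∘tabulate _ u)
    (dec-true (adjacent? v u) (clique v∈Q (p─q⊆p Q ⁅ v ⁆ u∈) (≢-sym (x∈p-y⇒x≢y Q u∈)))))

  -- The clique condition puts `Q - v` inside `N v`, and the added `f v` completes `Q - v` to `Q`.
  -- The term `sumOver Q f` is the same for every `v` in `Q`, so it cancels when two clique vertices
  -- are compared.
  S+f : ∀ {v} → v ∈ Q → (f : Fin n → ℕ) → S D f v + f v ≡ sumOver Q f + sumOver (N─Q v) f
  S+f {v} v∈Q f = begin
    S D f v + f v                                    ≡⟨ cong (_+ f v) (sumOver-─ (Q-v⊆N v∈Q) f) ⟩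
    sumOver (Q - v) f + sumOver (N─Q v) f + f v      ≡⟨ x+y+z≡z+x+y (sumOver (Q - v) f) _ _ ⟩
    f v + sumOver (Q - v) f + sumOver (N─Q v) f      ≡⟨ cong (_+ sumOver (N─Q v) f) (sumOver-remove v∈Q f) ⟨
    sumOver Q f + sumOver (N─Q v) f                  ∎
    where
    open ≡-Reasoning
    x+y+z≡z+x+y : ∀ x y z → x + y + z ≡ z + x + y
    x+y+z≡z+x+y = solve-∀

  d+1≡∣Q∣+∣N─Q∣ : ∀ {v} → v ∈ Q → d v + 1 ≡ ∣ Q ∣ + ∣ N─Q v ∣
  d+1≡∣Q∣+∣N─Q∣ {v} v∈Q = begin
    d v + 1                                           ≡⟨ cong (_+ 1) (sumOver-1 (N v)) ⟨
    -- Under the constant labeling 1, sums of labels count vertices.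
    S D (λ _ → 1) v + 1                               ≡⟨ S+f v∈Q (λ _ → 1) ⟩
    sumOver Q (λ _ → 1) + sumOver (N─Q v) (λ _ → 1)   ≡⟨ cong₂ _+_ (sumOver-1 Q) (sumOver-1 (N─Q v)) ⟩
    ∣ Q ∣ + ∣ N─Q v ∣                                 ∎
    where
    open ≡-Reasoning
    sumOver-1 : (p : Subset n) → sumOver p (λ _ → 1) ≡ ∣ p ∣
    sumOver-1 p = trans (sumOver-const p 1) (*-identityʳ _)

  -- Two clique vertices are joined by an arc, which the topological order directs from the smaller
  -- to the larger.
  S-strictlyIncreasing : TopologicallyOrdered → ∀ {f} → IsTopAddNumbering D f →
                         StrictlyIncreasingOn Q (S D f)
  S-strictlyIncreasing ordered (_ , inc) {u} {v} u∈Q v∈Q u<v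
    with clique u∈Q v∈Q (λ u≡v → <⇒≢ u<v (cong Fin.toℕ u≡v))
  ... | inj₁ u→v = inc u v u→v
  ... | inj₂ v→u = contradiction (ordered v→u) (<⇒≯ u<v)

  module _ (ordered : TopologicallyOrdered) {qF qL : Fin n}
           (smallest : IsSmallest Q qF) (largest : IsLargest Q qL) where

    ∣Q∣+S≤1+S : ∀ {f} → IsTopAddNumbering D f → ∣ Q ∣ + S D f qF ≤ suc (S D f qL)
    ∣Q∣+S≤1+S {f} num =
      -- The upper end is `suc (S D f qL)` because the interval excludes its upper end while
      -- `S D f qL` itself is attained.
      ∣p∣+a≤b Q (S D f) S-inc (m≤n⇒m≤1+n (mono qF∈Q qL∈Q (proj₂ smallest qL∈Q)))
        (λ v∈Q → mono qF∈Q v∈Q (proj₂ smallest v∈Q) , s≤s (mono v∈Q qL∈Q (proj₂ largest v∈Q)))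
      where
      qF∈Q = proj₁ smallest
      qL∈Q = proj₁ largest
      S-inc : StrictlyIncreasingOn Q (S D f)
      S-inc = S-strictlyIncreasing ordered num
      mono : ∀ {u v} → u ∈ Q → v ∈ Q → u Fin.≤ v → S D f u ≤ S D f v
      mono = strictlyIncreasing⇒≤ {g = S D f} S-inc

    ∣Q∣+f[N─Q]+f≤1+f[N─Q]+f : ∀ {f} → IsTopAddNumbering D f →
      ∣ Q ∣ + sumOver (N─Q qF) f + f qL ≤ suc (sumOver (N─Q qL) f + f qF)
    -- With `sumOver Q f` added to both sides, `S+f` applies at `qF` on the left and at `qL` on the
    -- right.
    ∣Q∣+f[N─Q]+f≤1+f[N─Q]+f {f} num = +-cancelˡ-≤ (sumOver Q f) _ _ (begin
      sumOver Q f + (∣ Q ∣ + sumOver (N─Q qF) f + f qL)   ≡⟨ eq₁ (sumOver Q f) ∣ Q ∣ _ (f qL) ⟩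
      ∣ Q ∣ + (sumOver Q f + sumOver (N─Q qF) f) + f qL   ≡⟨ cong (λ x → ∣ Q ∣ + x + f qL) (S+f (proj₁ smallest) f) ⟨
      ∣ Q ∣ + (S D f qF + f qF) + f qL                    ≡⟨ eq₂ ∣ Q ∣ (S D f qF) (f qF) (f qL) ⟩
      ∣ Q ∣ + S D f qF + (f qF + f qL)                    ≤⟨ +-monoˡ-≤ (f qF + f qL) (∣Q∣+S≤1+S num) ⟩
      suc (S D f qL) + (f qF + f qL)                      ≡⟨ eq₃ (S D f qL) (f qF) (f qL) ⟩
      suc (S D f qL + f qL + f qF)                        ≡⟨ cong (λ x → suc (x + f qF)) (S+f (proj₁ largest) f) ⟩
      suc (sumOver Q f + sumOver (N─Q qL) f + f qF)       ≡⟨ eq₄ (sumOver Q f) _ (f qF) ⟩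
      sumOver Q f + suc (sumOver (N─Q qL) f + f qF)       ∎)
      where
      open ≤-Reasoning
      eq₁ : ∀ a b c d → a + (b + c + d) ≡ b + (a + c) + d
      eq₁ = solve-∀
      eq₂ : ∀ a b c d → a + (b + c) + d ≡ a + b + (c + d)
      eq₂ = solve-∀
      eq₃ : ∀ a b c → suc a + (b + c) ≡ suc (a + c + b)
      eq₃ = solve-∀
      eq₄ : ∀ a b c → suc (a + b + c) ≡ a + suc (b + c)
      eq₄ = solve-∀

    d+1≤k*[d+2∸∣Q∣] : HasTopAddKNumbering D k → d qF + 1 ≤ k * (d qL + 2 ∸ ∣ Q ∣)
    d+1≤k*[d+2∸∣Q∣] {k} (f , num@(pos , _) , f≤k , _) = +-cancelˡ-≤ 1 _ _ (begin
      1 + (d qF + 1)                         ≡⟨ cong suc (d+1≡∣Q∣+∣N─Q∣ (proj₁ smallest)) ⟩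
      1 + (∣ Q ∣ + ∣ N─Q qF ∣)               ≡⟨ +-comm 1 _ ⟩
      -- Every label is at least 1; the final 1 makes room for `f qL`.
      ∣ Q ∣ + ∣ N─Q qF ∣ + 1                 ≤⟨ +-mono-≤ (+-monoʳ-≤ ∣ Q ∣ (∣p∣≤sumOver (N─Q qF) pos)) (pos qL) ⟩
      ∣ Q ∣ + sumOver (N─Q qF) f + f qL      ≤⟨ ∣Q∣+f[N─Q]+f≤1+f[N─Q]+f num ⟩
      -- At most `k` for each vertex of `N─Q qL` and once more for `qF`, hence the factor
      -- `suc ∣ N─Q qL ∣`.
      1 + (sumOver (N─Q qL) f + f qF)        ≤⟨ s≤s (+-mono-≤ (sumOver≤∣p∣*k (N─Q qL) f≤k) (f≤k qF)) ⟩
      1 + (∣ N─Q qL ∣ * k + k)               ≡⟨ cong suc (trans (+-comm _ k) (*-comm (suc ∣ N─Q qL ∣) k)) ⟩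
      1 + k * suc ∣ N─Q qL ∣                 ≡⟨ cong (λ x → 1 + k * x) d+2∸∣Q∣≡1+∣N─Q∣ ⟨
      1 + k * (d qL + 2 ∸ ∣ Q ∣)             ∎)
      where
      open ≤-Reasoning
      d+2∸∣Q∣≡1+∣N─Q∣ : d qL + 2 ∸ ∣ Q ∣ ≡ suc ∣ N─Q qL ∣
      d+2∸∣Q∣≡1+∣N─Q∣ = begin-equality
        d qL + 2 ∸ ∣ Q ∣                      ≡⟨ cong (_∸ ∣ Q ∣) (+-suc (d qL) 1) ⟩
        suc (d qL + 1) ∸ ∣ Q ∣                ≡⟨ cong (λ x → suc x ∸ ∣ Q ∣) (d+1≡∣Q∣+∣N─Q∣ (proj₁ largest)) ⟩
        suc (∣ Q ∣ + ∣ N─Q qL ∣) ∸ ∣ Q ∣      ≡⟨ cong (_∸ ∣ Q ∣) (+-suc ∣ Q ∣ _) ⟨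
        ∣ Q ∣ + suc ∣ N─Q qL ∣ ∸ ∣ Q ∣        ≡⟨ m+n∸m≡n ∣ Q ∣ _ ⟩
        suc ∣ N─Q qL ∣                        ∎

-- Opened only here because with the prefix +_ in scope terms like ∣ p ∣ + suc ∣ q ∣ parse ambiguously.
open import Data.Integer.Base using (+_; _≥_)

proposition1 : ∀ (n : ℕ) .{{_ : NonZero n}} (D : DAG n) → let open DAG D in
    Connected → TopologicallyOrdered → (num : HasTopAddNumbering D) →
    (Q : Subset n) → Nonempty Q → (clique : IsClique Q) →
    (qF qL : Fin n) → IsSmallest Q qF → (largest : IsLargest Q qL) →
    + ηₜ D num ≥ ⌈ _/_ (+ (d qF + 1)) (d qL + 2 ∸ ∣ Q ∣) {{d+2∸∣Q∣-nonZero D clique (proj₁ largest)}} ⌉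
proposition1 n D _ ordered num Q _ clique qF qL smallest largest =
  ⌈i/d⌉≤j (d qL + 2 ∸ ∣ Q ∣) {{d+2∸∣Q∣-nonZero D clique (proj₁ largest)}}
    (subst (+ (d qF + 1) ℤ.≤_) (ℤ.pos-* (ηₜ D num) _)
      -- `ηₜ D num` is itself attained by a numbering, so the bound holds with it as `k`.
      (ℤ.+≤+ (d+1≤k*[d+2∸∣Q∣] D clique ordered smallest largest (proj₁ (ηₜ-isLeast D num)))))
  where open DAG D
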